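{- $\left\{(r_0,r_1)\in\mathbb{R}^2 \mid -1<r_0-r_1\le -\tfrac12,\ r_1\ge 1+\sqrt5,\ r_1^2\ge 4r_0\right\}\subset\mathcal{D}_2^{(*)}$.
   Context: For $\mathbf{r}=(r_0,r_1)\in\mathbb{R}^2$, the two-dimensional shift radix system is the map $\tau_{\mathbf{r}}:\mathbb{Z}^2\to\mathbb{Z}^2$, $\tau_{\mathbf{r}}(a_0,a_1)=(a_1,-\lfloor r_0a_0+r_1a_1\rfloor)$. The orbit of $(a_0,a_1)$ is identified with the integer sequence $(a_n)_{n\ge 0}$ where $a_{n+2}=-\lfloor r_0a_n+r_1a_{n+1}\rfloor$ for $n\ge0$. An orbit is ultimately periodic if there are $n_0\ge 0$, $p>0$ with $a_{n+p}=a_n$ for all $n\ge n_0$; it ends up in the trivial cycle if $a_n=0$ for all sufficiently large $n$. $\mathcal{D}_2^{(*)}$ is the set of all $\mathbf{r}\in\mathbb{R}^2$ such that each ultimately periodic orbit of $\tau_{\mathbf{r}}$ ends up in the trivial cycle. -}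

module Defs where

open import Data.Integer.Base as ℤ using (ℤ; +_; 0ℤ)
import Data.Integer.Properties as ℤ
open import Data.Nat.Base as ℕ using (ℕ; zero; suc)
import Data.Nat.Properties as ℕ
open import Data.Product.Base using (∃; ∃₂; _×_; _,_)
open import Data.Rational.Base as ℚ using (ℚ; 0ℚ; 1ℚ; ½; ∣_∣; mkℚ; toℚᵘ)
import Data.Rational.Properties as ℚ
import Data.Rational.Solver as ℚ
open import Data.Rational.Unnormalised.Base as ℚᵘ using (mkℚᵘ; *<*)
import Data.Rational.Unnormalised.Properties as ℚᵘ
open import Data.Sum.Base using (inj₁; inj₂)
open import Level using (0ℓ)
open import Relation.Binary.PropositionalEquality
open import Relation.Nullary using (yes; no)
open import Relation.Unary using (Pred)

-- Real numbers: Cauchy sequences of rationals, with equality as the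
-- equivalence relation _≃_ below (no quotient is taken; every notion
-- used is invariant under _≃_).

IsCauchy : (ℕ → ℚ) → Set
IsCauchy x = ∀ ε → 0ℚ ℚ.< ε →
             ∃ λ N → ∀ m n → N ℕ.≤ m → N ℕ.≤ n → ∣ x m ℚ.- x n ∣ ℚ.< ε

record ℝ : Set where
  constructor mkℝ
  field
    seq    : ℕ → ℚ
    cauchy : IsCauchy seq

open ℝ public

infix 4 _<_ _≤_ _≃_

_<_ : ℝ → ℝ → Set
x < y = ∃ λ ε → 0ℚ ℚ.< ε ×
        ∃ λ N → ∀ n → N ℕ.≤ n → seq x n ℚ.+ ε ℚ.≤ seq y n

_≤_ : ℝ → ℝ → Set
x ≤ y = ∀ ε → 0ℚ ℚ.< ε →
        ∃ λ N → ∀ n → N ℕ.≤ n → seq x n ℚ.≤ seq y n ℚ.+ ε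

_≃_ : ℝ → ℝ → Set
x ≃ y = x ≤ y × y ≤ x

fromℚ : ℚ → ℝ
fromℚ q = mkℝ (λ _ → q) λ ε 0<ε → 0 , λ _ _ _ _ →
  subst (ℚ._< ε) (sym (cong ∣_∣ (ℚ.+-inverseʳ q))) 0<ε

fromℤ : ℤ → ℝ
fromℤ i = fromℚ (i ℚ./ 1)

private
  open ℚ.+-*-Solver using (solve; _:=_; _:+_; _:*_; _:-_; :-_)

  infixl 7 _·_
  _·_ : ℚ → ℚ → ℚ
  _·_ = ℚ._*_

  pos·pos : ∀ {p q} → 0ℚ ℚ.< p → 0ℚ ℚ.< q → 0ℚ ℚ.< p · q
  pos·pos {p} {q} 0<p 0<q =
    ℚ.positive⁻¹ _ {{ℚ.pos*pos⇒pos p {{ℚ.positive 0<p}} q {{ℚ.positive 0<q}}}}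

  ·-mono-< : ∀ b p q r → 0ℚ ℚ.< b → 0ℚ ℚ.≤ p → r ℚ.≤ b → p ℚ.< q → r · p ℚ.< b · q
  ·-mono-< b p q r 0<b 0≤p r≤b p<q = ℚ.≤-<-trans
    (ℚ.*-monoʳ-≤-nonNeg p {{ℚ.nonNegative 0≤p}} r≤b)
    (ℚ.*-monoʳ-<-pos b {{ℚ.positive 0<b}} p<q)

  halves : ∀ ε → ½ · ε ℚ.+ ½ · ε ≡ ε
  halves ε = trans (sym (ℚ.*-distribʳ-+ ε ½ ½)) (ℚ.*-identityˡ ε)

  ∣-∣-comm : ∀ p q → ∣ p ℚ.- q ∣ ≡ ∣ q ℚ.- p ∣
  ∣-∣-comm p q = trans (sym (ℚ.∣-p∣≡∣p∣ _))
    (cong ∣_∣ (solve 2 (λ p q → :- (p :- q) := q :- p) refl p q))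

  +-cauchy : ∀ {x y} → IsCauchy x → IsCauchy y → IsCauchy (λ n → x n ℚ.+ y n)
  +-cauchy {x} {y} cx cy ε 0<ε
    with cx (½ · ε) (pos·pos (ℚ.positive⁻¹ ½) 0<ε)
       | cy (½ · ε) (pos·pos (ℚ.positive⁻¹ ½) 0<ε)
  ... | M , hM | N , hN = M ℕ.⊔ N , λ m n ≤m ≤n → let open ℚ.≤-Reasoning in begin-strict
    ∣ (x m ℚ.+ y m) ℚ.- (x n ℚ.+ y n) ∣
      ≡⟨ cong ∣_∣ (solve 4 (λ a b c d → (a :+ b) :- (c :+ d) := (a :- c) :+ (b :- d))
                   refl (x m) (y m) (x n) (y n)) ⟩
    ∣ (x m ℚ.- x n) ℚ.+ (y m ℚ.- y n) ∣
      ≤⟨ ℚ.∣p+q∣≤∣p∣+∣q∣ (x m ℚ.- x n) (y m ℚ.- y n) ⟩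
    ∣ x m ℚ.- x n ∣ ℚ.+ ∣ y m ℚ.- y n ∣
      <⟨ ℚ.+-mono-< (hM m n (ℕ.m⊔n≤o⇒m≤o M N ≤m) (ℕ.m⊔n≤o⇒m≤o M N ≤n))
                    (hN m n (ℕ.m⊔n≤o⇒n≤o M N ≤m) (ℕ.m⊔n≤o⇒n≤o M N ≤n)) ⟩
    ½ · ε ℚ.+ ½ · ε
      ≡⟨ halves ε ⟩
    ε ∎

  neg-cauchy : ∀ {x} → IsCauchy x → IsCauchy (λ n → ℚ.- x n)
  neg-cauchy {x} cx ε 0<ε with cx ε 0<ε
  ... | N , h = N , λ m n ≤m ≤n → subst (ℚ._< ε)
    (trans (sym (ℚ.∣-p∣≡∣p∣ _)) (cong ∣_∣ (ℚ.neg-distrib-+ (x m) (ℚ.- x n))))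
    (h m n ≤m ≤n)

  bounded : ∀ {x} → IsCauchy x →
            ∃ λ B → 0ℚ ℚ.< B × ∃ λ N → ∀ n → N ℕ.≤ n → ∣ x n ∣ ℚ.≤ B
  bounded {x} cx with cx 1ℚ (ℚ.positive⁻¹ 1ℚ)
  ... | N , h = ∣ x N ∣ ℚ.+ 1ℚ
    , ℚ.+-mono-≤-< (ℚ.0≤∣p∣ (x N)) (ℚ.positive⁻¹ 1ℚ)
    , N , λ n ≤n → let open ℚ.≤-Reasoning in begin
      ∣ x n ∣
        ≡⟨ cong ∣_∣ (solve 2 (λ a b → a := b :+ (a :- b)) refl (x n) (x N)) ⟩
      ∣ x N ℚ.+ (x n ℚ.- x N) ∣
        ≤⟨ ℚ.∣p+q∣≤∣p∣+∣q∣ (x N) _ ⟩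
      ∣ x N ∣ ℚ.+ ∣ x n ℚ.- x N ∣
        ≤⟨ ℚ.+-monoʳ-≤ ∣ x N ∣ (ℚ.<⇒≤ (h n N ≤n ℕ.≤-refl)) ⟩
      ∣ x N ∣ ℚ.+ 1ℚ ∎

  divide : ∀ c ε → 0ℚ ℚ.< c → 0ℚ ℚ.< ε → ∃ λ δ → 0ℚ ℚ.< δ × c · δ ≡ ε
  divide c ε 0<c 0<ε = c⁻¹ · ε
    , pos·pos (ℚ.positive⁻¹ c⁻¹ {{ℚ.1/pos⇒pos c {{ℚ.positive 0<c}}}}) 0<ε
    , trans (sym (ℚ.*-assoc c c⁻¹ ε))
        (trans (cong (_· ε) (ℚ.*-inverseʳ c {{c≢0}})) (ℚ.*-identityˡ ε))
    where
    c≢0 = ℚ.pos⇒nonZero c {{ℚ.positive 0<c}}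
    c⁻¹ = (ℚ.1/ c) {{c≢0}}

  ∣-∣-product : ∀ a b c d → ∣ a · b ℚ.- c · d ∣ ℚ.≤
                            ∣ a ∣ · ∣ b ℚ.- d ∣ ℚ.+ ∣ d ∣ · ∣ a ℚ.- c ∣
  ∣-∣-product a b c d = let open ℚ.≤-Reasoning in begin
    ∣ a · b ℚ.- c · d ∣
      ≡⟨ cong ∣_∣ (solve 4 (λ a b c d → a :* b :- c :* d := a :* (b :- d) :+ d :* (a :- c))
                   refl a b c d) ⟩
    ∣ a · (b ℚ.- d) ℚ.+ d · (a ℚ.- c) ∣
      ≤⟨ ℚ.∣p+q∣≤∣p∣+∣q∣ (a · (b ℚ.- d)) (d · (a ℚ.- c)) ⟩
    ∣ a · (b ℚ.- d) ∣ ℚ.+ ∣ d · (a ℚ.- c) ∣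
      ≡⟨ cong₂ ℚ._+_ (ℚ.∣p*q∣≡∣p∣*∣q∣ a (b ℚ.- d)) (ℚ.∣p*q∣≡∣p∣*∣q∣ d (a ℚ.- c)) ⟩
    ∣ a ∣ · ∣ b ℚ.- d ∣ ℚ.+ ∣ d ∣ · ∣ a ℚ.- c ∣ ∎

  ∣-∣-product-< : ∀ a b c d B C δ → 0ℚ ℚ.< B → 0ℚ ℚ.< C →
    ∣ a ∣ ℚ.≤ B → ∣ d ∣ ℚ.≤ C → ∣ a ℚ.- c ∣ ℚ.< δ → ∣ b ℚ.- d ∣ ℚ.< δ →
    ∣ a · b ℚ.- c · d ∣ ℚ.< (B ℚ.+ C) · δ
  ∣-∣-product-< a b c d B C δ 0<B 0<C a≤B d≤C ac<δ bd<δ = let open ℚ.≤-Reasoning in begin-strict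
    ∣ a · b ℚ.- c · d ∣
      ≤⟨ ∣-∣-product a b c d ⟩
    ∣ a ∣ · ∣ b ℚ.- d ∣ ℚ.+ ∣ d ∣ · ∣ a ℚ.- c ∣
      <⟨ ℚ.+-mono-< (·-mono-< B (∣ b ℚ.- d ∣) δ (∣ a ∣) 0<B (ℚ.0≤∣p∣ (b ℚ.- d)) a≤B bd<δ)
                    (·-mono-< C (∣ a ℚ.- c ∣) δ (∣ d ∣) 0<C (ℚ.0≤∣p∣ (a ℚ.- c)) d≤C ac<δ) ⟩
    B · δ ℚ.+ C · δ
      ≡⟨ ℚ.*-distribʳ-+ δ B C ⟨
    (B ℚ.+ C) · δ ∎

  *-cauchy : ∀ {x y} → IsCauchy x → IsCauchy y → IsCauchy (λ n → x n · y n)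
  *-cauchy {x} {y} cx cy ε 0<ε =
    let B , 0<B , K , hK = bounded {x} cx
        C , 0<C , L , hL = bounded {y} cy
        δ , 0<δ , [B+C]δ≡ε = divide (B ℚ.+ C) ε (ℚ.+-mono-< 0<B 0<C) 0<ε
        M , hM = cx δ 0<δ
        N , hN = cy δ 0<δ
        KL = K ℕ.⊔ L
        MN = M ℕ.⊔ N
    in KL ℕ.⊔ MN , λ m n ≤m ≤n →
      let KL≤m = ℕ.m⊔n≤o⇒m≤o KL MN ≤m
          KL≤n = ℕ.m⊔n≤o⇒m≤o KL MN ≤n
          MN≤m = ℕ.m⊔n≤o⇒n≤o KL MN ≤m
          MN≤n = ℕ.m⊔n≤o⇒n≤o KL MN ≤n
      in subst (∣ x m · y m ℚ.- x n · y n ∣ ℚ.<_) [B+C]δ≡ε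
        (∣-∣-product-< (x m) (y m) (x n) (y n) B C δ 0<B 0<C
          (hK m (ℕ.m⊔n≤o⇒m≤o K L KL≤m)) (hL n (ℕ.m⊔n≤o⇒n≤o K L KL≤n))
          (hM m n (ℕ.m⊔n≤o⇒m≤o M N MN≤m) (ℕ.m⊔n≤o⇒m≤o M N MN≤n))
          (hN m n (ℕ.m⊔n≤o⇒n≤o M N MN≤m) (ℕ.m⊔n≤o⇒n≤o M N MN≤n)))

infix  8 -_
infixl 7 _*_
infixl 6 _+_ _-_

_+_ : ℝ → ℝ → ℝ
x + y = mkℝ (λ n → seq x n ℚ.+ seq y n) (+-cauchy {seq x} {seq y} (cauchy x) (cauchy y))

-_ : ℝ → ℝ
- x = mkℝ (λ n → ℚ.- seq x n) (neg-cauchy {seq x} (cauchy x))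

_-_ : ℝ → ℝ → ℝ
x - y = x + (- y)

_*_ : ℝ → ℝ → ℝ
x * y = mkℝ (λ n → seq x n ℚ.* seq y n) (*-cauchy {seq x} {seq y} (cauchy x) (cauchy y))

-- ⌊√ n ⌋, characterised by ⌊√⌋-lower and ⌊√⌋-upper.
⌊√_⌋ : ℕ → ℕ
⌊√ zero ⌋ = 0
⌊√ suc n ⌋ with suc ⌊√ n ⌋ ℕ.* suc ⌊√ n ⌋ ℕ.≤? suc n
... | yes _ = suc ⌊√ n ⌋
... | no  _ = ⌊√ n ⌋

⌊√⌋-lower : ∀ n → ⌊√ n ⌋ ℕ.* ⌊√ n ⌋ ℕ.≤ n
⌊√⌋-lower zero = ℕ.z≤n
⌊√⌋-lower (suc n) with suc ⌊√ n ⌋ ℕ.* suc ⌊√ n ⌋ ℕ.≤? suc n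
... | yes p = p
... | no  _ = ℕ.m≤n⇒m≤1+n (⌊√⌋-lower n)

⌊√⌋-upper : ∀ n → n ℕ.< suc ⌊√ n ⌋ ℕ.* suc ⌊√ n ⌋
⌊√⌋-upper zero = ℕ.s≤s ℕ.z≤n
⌊√⌋-upper (suc n) with suc ⌊√ n ⌋ ℕ.* suc ⌊√ n ⌋ ℕ.≤? suc n
... | yes _ = ℕ.≤-<-trans (⌊√⌋-upper n) (ℕ.*-mono-< (ℕ.n<1+n (suc ⌊√ n ⌋)) (ℕ.n<1+n (suc ⌊√ n ⌋)))
... | no ¬p = ℕ.≰⇒> ¬p

private
  √-seq : ℕ → ℕ → ℚ
  √-seq k n = (+ ⌊√ k ℕ.* (suc n ℕ.* suc n) ⌋) ℚ./ suc n

  square-cancel-< : ∀ {a b} → a ℕ.* a ℕ.< b ℕ.* b → a ℕ.< b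
  square-cancel-< {a} {b} p = ℕ.≰⇒> λ b≤a → ℕ.<⇒≱ p (ℕ.*-mono-≤ b≤a b≤a)

  /-mono-< : ∀ a b m n → a ℕ.* suc n ℕ.< b ℕ.* suc m →
             (+ a) ℚ./ suc m ℚ.< (+ b) ℚ./ suc n
  /-mono-< a b m n p = ℚ.toℚᵘ-cancel-< (let open ℚᵘ.≤-Reasoning in begin-strict
    toℚᵘ ((+ a) ℚ./ suc m)  ≃⟨ ℚ.toℚᵘ-fromℚᵘ (mkℚᵘ (+ a) m) ⟩
    mkℚᵘ (+ a) m            <⟨ *<* (subst₂ ℤ._<_ (ℤ.pos-* a (suc n)) (ℤ.pos-* b (suc m)) (ℤ.+<+ p)) ⟩
    mkℚᵘ (+ b) n            ≃⟨ ℚ.toℚᵘ-fromℚᵘ (mkℚᵘ (+ b) n) ⟨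
    toℚᵘ ((+ b) ℚ./ suc n)  ∎)

  /-suc : ∀ b n → (+ suc b) ℚ./ suc n ≡ (+ b) ℚ./ suc n ℚ.+ (+ 1) ℚ./ suc n
  /-suc b n = ℚ.toℚᵘ-injective (let open ℚᵘ.≤-Reasoning in begin-equality
    toℚᵘ ((+ suc b) ℚ./ suc n)
      ≃⟨ ℚ.toℚᵘ-fromℚᵘ (mkℚᵘ (+ suc b) n) ⟩
    mkℚᵘ (+ suc b) n
      ≃⟨ ℚᵘ.*≡* num ⟩
    mkℚᵘ (+ b) n ℚᵘ.+ mkℚᵘ (+ 1) n
      ≃⟨ ℚᵘ.+-cong (ℚ.toℚᵘ-fromℚᵘ (mkℚᵘ (+ b) n)) (ℚ.toℚᵘ-fromℚᵘ (mkℚᵘ (+ 1) n)) ⟨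
    toℚᵘ ((+ b) ℚ./ suc n) ℚᵘ.+ toℚᵘ ((+ 1) ℚ./ suc n)
      ≃⟨ ℚ.toℚᵘ-homo-+ ((+ b) ℚ./ suc n) ((+ 1) ℚ./ suc n) ⟨
    toℚᵘ ((+ b) ℚ./ suc n ℚ.+ (+ 1) ℚ./ suc n) ∎)
    where
    P = suc n
    num : + suc b ℤ.* + (P ℕ.* P) ≡ (+ b ℤ.* + P ℤ.+ + 1 ℤ.* + P) ℤ.* + P
    num = begin
      + suc b ℤ.* + (P ℕ.* P)                ≡⟨ cong (+ suc b ℤ.*_) (ℤ.pos-* P P) ⟩
      + suc b ℤ.* (+ P ℤ.* + P)              ≡⟨ ℤ.*-assoc (+ suc b) (+ P) (+ P) ⟨
      + suc b ℤ.* + P ℤ.* + P                ≡⟨ cong (λ i → i ℤ.* + P ℤ.* + P) (ℤ.+-comm (+ 1) (+ b)) ⟩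
      (+ b ℤ.+ + 1) ℤ.* + P ℤ.* + P          ≡⟨ cong (ℤ._* + P) (ℤ.*-distribʳ-+ (+ P) (+ b) (+ 1)) ⟩
      (+ b ℤ.* + P ℤ.+ + 1 ℤ.* + P) ℤ.* + P  ∎
      where open ≡-Reasoning

  √-close : ∀ k m n → √-seq k m ℚ.< √-seq k n ℚ.+ (+ 1) ℚ./ suc n
  √-close k m n = subst (√-seq k m ℚ.<_) (/-suc b n)
    (/-mono-< a (suc b) m n (square-cancel-< (let open ℕ.≤-Reasoning in begin-strict
      (a ℕ.* P) ℕ.* (a ℕ.* P)          ≡⟨ ℕ.[m*n]*[o*p]≡[m*o]*[n*p] a P a P ⟩
      (a ℕ.* a) ℕ.* (P ℕ.* P)          ≤⟨ ℕ.*-monoˡ-≤ (P ℕ.* P) (⌊√⌋-lower (k ℕ.* (M ℕ.* M))) ⟩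
      (k ℕ.* (M ℕ.* M)) ℕ.* (P ℕ.* P)  ≡⟨ swap k (M ℕ.* M) (P ℕ.* P) ⟩
      (k ℕ.* (P ℕ.* P)) ℕ.* (M ℕ.* M)  <⟨ ℕ.*-monoˡ-< (M ℕ.* M) (⌊√⌋-upper (k ℕ.* (P ℕ.* P))) ⟩
      (suc b ℕ.* suc b) ℕ.* (M ℕ.* M)  ≡⟨ ℕ.[m*n]*[o*p]≡[m*o]*[n*p] (suc b) (suc b) M M ⟩
      (suc b ℕ.* M) ℕ.* (suc b ℕ.* M)  ∎)))
    where
    M = suc m
    P = suc n
    a = ⌊√ k ℕ.* (M ℕ.* M) ⌋
    b = ⌊√ k ℕ.* (P ℕ.* P) ⌋
    swap : ∀ x y z → (x ℕ.* y) ℕ.* z ≡ (x ℕ.* z) ℕ.* y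
    swap x y z = trans (ℕ.*-assoc x y z) (trans (cong (x ℕ.*_) (ℕ.*-comm y z)) (sym (ℕ.*-assoc x z y)))

  archimedean : ∀ ε → 0ℚ ℚ.< ε → ∃ λ N → ∀ n → N ℕ.≤ n → (+ 1) ℚ./ suc n ℚ.< ε
  archimedean ε@(mkℚ (ℤ.+ zero) d c) (ℚ.*<* (ℤ.+<+ ()))
  archimedean ε@(mkℚ ℤ.+[1+ p ] d c) 0<ε = suc d , λ n d<n →
    subst ((+ 1) ℚ./ suc n ℚ.<_) (ℚ.fromℚᵘ-toℚᵘ ε)
      (/-mono-< 1 (suc p) n d (let open ℕ.≤-Reasoning in begin-strict
        1 ℕ.* suc d        ≡⟨ ℕ.*-identityˡ (suc d) ⟩
        suc d              <⟨ ℕ.s≤s d<n ⟩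
        suc n              ≤⟨ ℕ.m≤n*m (suc n) (suc p) ⟩
        suc p ℕ.* suc n    ∎))
  archimedean ε@(mkℚ ℤ.-[1+ p ] d c) (ℚ.*<* ())

  ∣-∣-< : ∀ {p q ε} → p ℚ.< q ℚ.+ ε → q ℚ.< p ℚ.+ ε → ∣ p ℚ.- q ∣ ℚ.< ε
  ∣-∣-< {p} {q} {ε} p< q< with ℚ.∣p∣≡p∨∣p∣≡-p (p ℚ.- q)
  ... | inj₁ eq = subst₂ ℚ._<_ (sym eq)
    (solve 2 (λ q ε → q :+ ε :- q := ε) refl q ε) (ℚ.+-monoˡ-< (ℚ.- q) p<)
  ... | inj₂ eq = subst₂ ℚ._<_
    (trans (solve 2 (λ p q → q :- p := :- (p :- q)) refl p q) (sym eq))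
    (solve 2 (λ q ε → q :+ ε :- q := ε) refl p ε) (ℚ.+-monoˡ-< (ℚ.- p) q<)

  √-cauchy : ∀ k → IsCauchy (√-seq k)
  √-cauchy k ε 0<ε with archimedean ε 0<ε
  ... | N , h = N , λ m n ≤m ≤n → ∣-∣-<
    (ℚ.<-trans (√-close k m n) (ℚ.+-monoʳ-< (√-seq k n) (h n ≤n)))
    (ℚ.<-trans (√-close k n m) (ℚ.+-monoʳ-< (√-seq k m) (h m ≤m)))

-- The n-th approximation is ⌊ (n+1) √k ⌋ / (n+1).
√_ : ℕ → ℝ
√ k = mkℝ (√-seq k) (√-cauchy k)

private
  √-seq-lower : ∀ k n → √-seq k n · √-seq k n ℚ.≤ (+ k) ℚ./ 1
  √-seq-lower k n = ℚ.toℚᵘ-cancel-≤ (let open ℚᵘ.≤-Reasoning in begin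
    toℚᵘ (s · s)                     ≃⟨ ℚ.toℚᵘ-homo-* s s ⟩
    toℚᵘ s ℚᵘ.* toℚᵘ s               ≃⟨ ℚᵘ.*-cong s≃ s≃ ⟩
    mkℚᵘ (+ a) n ℚᵘ.* mkℚᵘ (+ a) n   ≤⟨ ℚᵘ.*≤* (subst₂ ℤ._≤_
      (trans (ℤ.pos-* a a) (sym (ℤ.*-identityʳ _))) (ℤ.pos-* k (suc n ℕ.* suc n))
      (ℤ.+≤+ (⌊√⌋-lower (k ℕ.* (suc n ℕ.* suc n))))) ⟩
    mkℚᵘ (+ k) 0                     ≃⟨ ℚ.toℚᵘ-fromℚᵘ (mkℚᵘ (+ k) 0) ⟨
    toℚᵘ ((+ k) ℚ./ 1)               ∎)
    where
    a = ⌊√ k ℕ.* (suc n ℕ.* suc n) ⌋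
    s = √-seq k n
    s≃ = ℚ.toℚᵘ-fromℚᵘ (mkℚᵘ (+ a) n)

  √-seq-upper : ∀ k n → let t = √-seq k n ℚ.+ (+ 1) ℚ./ suc n in
                (+ k) ℚ./ 1 ℚ.≤ t · t
  √-seq-upper k n = subst (λ t → (+ k) ℚ./ 1 ℚ.≤ t · t) (/-suc a n)
    (ℚ.toℚᵘ-cancel-≤ (let open ℚᵘ.≤-Reasoning in begin
    toℚᵘ ((+ k) ℚ./ 1)                       ≃⟨ ℚ.toℚᵘ-fromℚᵘ (mkℚᵘ (+ k) 0) ⟩
    mkℚᵘ (+ k) 0                             ≤⟨ ℚᵘ.*≤* (subst₂ ℤ._≤_
      (ℤ.pos-* k (suc n ℕ.* suc n)) (trans (ℤ.pos-* (suc a) (suc a)) (sym (ℤ.*-identityʳ _)))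
      (ℤ.+≤+ (ℕ.<⇒≤ (⌊√⌋-upper (k ℕ.* (suc n ℕ.* suc n)))))) ⟩
    mkℚᵘ (+ suc a) n ℚᵘ.* mkℚᵘ (+ suc a) n   ≃⟨ ℚᵘ.*-cong t≃ t≃ ⟨
    toℚᵘ t ℚᵘ.* toℚᵘ t                       ≃⟨ ℚ.toℚᵘ-homo-* t t ⟨
    toℚᵘ (t · t)                             ∎))
    where
    a = ⌊√ k ℕ.* (suc n ℕ.* suc n) ⌋
    t = (+ suc a) ℚ./ suc n
    t≃ = ℚ.toℚᵘ-fromℚᵘ (mkℚᵘ (+ suc a) n)

  √-seq-nonNeg : ∀ k n → 0ℚ ℚ.≤ √-seq k n
  √-seq-nonNeg k n = ℚ.nonNegative⁻¹ (√-seq k n)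
    {{ℚ.normalize-nonNeg ⌊√ k ℕ.* (suc n ℕ.* suc n) ⌋ (suc n)}}

  pos2B+1 : ∀ B → 0ℚ ℚ.< B → 0ℚ ℚ.< (B ℚ.+ B) ℚ.+ 1ℚ
  pos2B+1 B 0<B = ℚ.+-mono-< (ℚ.+-mono-< 0<B 0<B) (ℚ.positive⁻¹ 1ℚ)

  square-+ : ∀ s u B δ → 0ℚ ℚ.≤ u → 0ℚ ℚ.< B → s ℚ.≤ B → u ℚ.≤ 1ℚ → u ℚ.≤ δ →
             (s ℚ.+ u) · (s ℚ.+ u) ℚ.≤ s · s ℚ.+ ((B ℚ.+ B) ℚ.+ 1ℚ) · δ
  square-+ s u B δ 0≤u 0<B s≤B u≤1 u≤δ = let open ℚ.≤-Reasoning in begin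
    (s ℚ.+ u) · (s ℚ.+ u)
      ≡⟨ solve 2 (λ s u → (s :+ u) :* (s :+ u) := s :* s :+ ((s :+ s) :+ u) :* u) refl s u ⟩
    s · s ℚ.+ ((s ℚ.+ s) ℚ.+ u) · u
      ≤⟨ ℚ.+-monoʳ-≤ (s · s) (ℚ.*-monoʳ-≤-nonNeg u {{ℚ.nonNegative 0≤u}}
           (ℚ.+-mono-≤ (ℚ.+-mono-≤ s≤B s≤B) u≤1)) ⟩
    s · s ℚ.+ ((B ℚ.+ B) ℚ.+ 1ℚ) · u
      ≤⟨ ℚ.+-monoʳ-≤ (s · s) (ℚ.*-monoˡ-≤-nonNeg ((B ℚ.+ B) ℚ.+ 1ℚ)
           {{ℚ.nonNegative (ℚ.<⇒≤ (pos2B+1 B 0<B))}} u≤δ) ⟩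
    s · s ℚ.+ ((B ℚ.+ B) ℚ.+ 1ℚ) · δ ∎

0≤√ : ∀ k → fromℤ 0ℤ ≤ √ k
0≤√ k ε 0<ε = 0 , λ n _ → ℚ.≤-trans (√-seq-nonNeg k n)
  (ℚ.≤-trans (ℚ.≤-reflexive (sym (ℚ.+-identityʳ _))) (ℚ.+-monoʳ-≤ (√-seq k n) (ℚ.<⇒≤ 0<ε)))

√-square : ∀ k → √ k * √ k ≃ fromℤ (+ k)
√-square k = lower , upper
  where
  lower : √ k * √ k ≤ fromℤ (+ k)
  lower ε 0<ε = 0 , λ n _ → ℚ.≤-trans (√-seq-lower k n)
    (ℚ.≤-trans (ℚ.≤-reflexive (sym (ℚ.+-identityʳ _)))
      (ℚ.+-monoʳ-≤ ((+ k) ℚ./ 1) (ℚ.<⇒≤ 0<ε)))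

  upper : fromℤ (+ k) ≤ √ k * √ k
  upper ε 0<ε =
    let B , 0<B , M , hM = bounded {√-seq k} (√-cauchy k)
        δ , 0<δ , Cδ≡ε = divide ((B ℚ.+ B) ℚ.+ 1ℚ) ε (pos2B+1 B 0<B) 0<ε
        N , hN = archimedean δ 0<δ
        L , hL = archimedean 1ℚ (ℚ.positive⁻¹ 1ℚ)
        NL = N ℕ.⊔ L
    in M ℕ.⊔ NL , λ n ≤n →
      let NL≤n = ℕ.m⊔n≤o⇒n≤o M NL ≤n
          0≤s = √-seq-nonNeg k n
      in ℚ.≤-trans (√-seq-upper k n)
        (subst (λ e → t k n · t k n ℚ.≤ √-seq k n · √-seq k n ℚ.+ e) Cδ≡ε
          (square-+ (√-seq k n) ((+ 1) ℚ./ suc n) B δ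
            (ℚ.nonNegative⁻¹ ((+ 1) ℚ./ suc n) {{ℚ.normalize-nonNeg 1 (suc n)}}) 0<B
            (subst (ℚ._≤ B) (ℚ.0≤p⇒∣p∣≡p 0≤s) (hM n (ℕ.m⊔n≤o⇒m≤o M NL ≤n)))
            (ℚ.<⇒≤ (hL n (ℕ.m⊔n≤o⇒n≤o N L NL≤n)))
            (ℚ.<⇒≤ (hN n (ℕ.m⊔n≤o⇒m≤o N L NL≤n)))))
    where
    t : ℕ → ℕ → ℚ
    t k n = √-seq k n ℚ.+ (+ 1) ℚ./ suc n

_IsFloorOf_ : ℤ → ℝ → Set
k IsFloorOf x = fromℤ k ≤ x × x < fromℤ (k ℤ.+ + 1)

-- The map τ_r, given by its graph: the floor function is not computable
-- on Cauchy reals.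
τ⟨_⟩_↦_ : ℝ × ℝ → ℤ × ℤ → ℤ × ℤ → Set
τ⟨ r₀ , r₁ ⟩ (a₀ , a₁) ↦ b =
  ∃ λ k → k IsFloorOf (r₀ * fromℤ a₀ + r₁ * fromℤ a₁) × b ≡ (a₁ , ℤ.- k)

-- The orbit of (a 0 , a 1) under τ_r, identified with an integer sequence.
IsOrbit : ℝ × ℝ → (ℕ → ℤ) → Set
IsOrbit r a = ∀ n → τ⟨ r ⟩ (a n , a (1 ℕ.+ n)) ↦ (a (1 ℕ.+ n) , a (2 ℕ.+ n))

UltimatelyPeriodic : (ℕ → ℤ) → Set
UltimatelyPeriodic a =
  ∃₂ λ n₀ p → 0 ℕ.< p × (∀ n → n₀ ℕ.≤ n → a (n ℕ.+ p) ≡ a n)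

EndsInTrivialCycle : (ℕ → ℤ) → Set
EndsInTrivialCycle a = ∃ λ n₀ → ∀ n → n₀ ℕ.≤ n → a n ≡ 0ℤ

𝒟₂⁽*⁾ : Pred (ℝ × ℝ) 0ℓ
𝒟₂⁽*⁾ r = ∀ a → IsOrbit r a → UltimatelyPeriodic a → EndsInTrivialCycle a

{-# OPTIONS --safe #-}

-- Put q = r₁ − 1, ε = r₀ − r₁ + 1 and, for a periodic orbit a, let
-- d n = a n + a (n+1), u n = a n + d n and e n = r₀ a n + r₁ a (n+1) + a (n+2),
-- so that 0 ≤ e n < 1. Running the recurrence backwards gives
--   (q + ε) d n = e n + ε u (n+1) − (1 + ε) d (n+1),
--   (q + ε) u n = 2 e n − (q − ε) u (n+1) + (q − 2 − ε) d (n+1).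
-- Comparing maxima over a period yields (2 (q − 1) − |q − 2 − ε|) max|d| ≤ 4;
-- as 3 q > 6 + ε, this forces |d| < 2, so d takes values in {−1, 0, 1}. Since
-- 0 ≤ (q + ε) d n + (q + 1) d (n+1) + d (n+2) < 2, following a nonzero value
-- of d for a few steps is contradictory, whence d = 0. Then
-- e n = ε a n = − e (n+1), which leaves only a = 0.
--
-- The argument tolerates −η ≤ e n for small η > 0. By periodicity only finitely
-- many constraints are involved, so r₀ and r₁ may be replaced by sufficiently
-- good rational approximations.
module Submission where

open import Defs
open import Data.Empty using (⊥; ⊥-elim)
open import Data.Integer.Base as ℤ using (ℤ; +_; -[1+_]; 0ℤ)
import Data.Integer.Properties as ℤ
open import Data.List.Base using (upTo)
import Data.List.Extrema
open import Data.List.Membership.Propositional.Properties using (∈-upTo⁺)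
import Data.List.Relation.Unary.All as All
open import Data.Nat.Base as ℕ using (ℕ; zero; suc)
open import Data.Nat.DivMod using (_%_; m≡m%n+[m/n]*n; m%n<n)
import Data.Nat.Properties as ℕ
open import Data.Product.Base using (∃; _×_; _,_; proj₁; proj₂)
open import Data.Rational.Base as ℚ using (ℚ; 0ℚ; 1ℚ; -½; ∣_∣; toℚᵘ)
import Data.Rational.Properties as ℚ
import Data.Rational.Solver as ℚ
open import Data.Rational.Unnormalised.Base as ℚᵘ using (mkℚᵘ; *≡*; *<*)
import Data.Rational.Unnormalised.Properties as ℚᵘ
open import Data.Sum.Base using (_⊎_; inj₁; inj₂)
open import Relation.Binary.Bundles using (DecTotalOrder)
open import Relation.Binary.PropositionalEquality
open import Relation.Nullary.Decidable using (True; toWitness)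
open import Relation.Unary using (_⊆_)

open ℚ.+-*-Solver using (solve; con; _:=_; _:+_; _:*_; _:-_; :-_)

private
  infixl 7 _·_
  _·_ : ℚ → ℚ → ℚ
  _·_ = ℚ._*_

  infixl 6 _⊕_ _⊖_
  _⊕_ _⊖_ : ℚ → ℚ → ℚ
  _⊕_ = ℚ._+_
  _⊖_ = ℚ._-_

  2ℚ 3ℚ 4ℚ 6ℚ ¼ 1/100 11/5 : ℚ
  2ℚ    = + 2 ℚ./ 1
  3ℚ    = + 3 ℚ./ 1
  4ℚ    = + 4 ℚ./ 1
  6ℚ    = + 6 ℚ./ 1
  ¼     = + 1 ℚ./ 4
  1/100 = + 1 ℚ./ 100
  11/5  = + 11 ℚ./ 5

-- Linear arithmetic

p≤q⇒0≤q-p : ∀ {p q} → p ℚ.≤ q → 0ℚ ℚ.≤ q ⊖ p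
p≤q⇒0≤q-p {p} {q} p≤q = subst (ℚ._≤ q ⊖ p) (ℚ.+-inverseʳ p) (ℚ.+-monoˡ-≤ (ℚ.- p) p≤q)

p<q⇒0<q-p : ∀ {p q} → p ℚ.< q → 0ℚ ℚ.< q ⊖ p
p<q⇒0<q-p {p} {q} p<q = subst (ℚ._< q ⊖ p) (ℚ.+-inverseʳ p) (ℚ.+-monoˡ-< (ℚ.- p) p<q)

0≤q-p⇒p≤q : ∀ {p q} → 0ℚ ℚ.≤ q ⊖ p → p ℚ.≤ q
0≤q-p⇒p≤q {p} {q} h = subst₂ ℚ._≤_ (ℚ.+-identityˡ p)
  (solve 2 (λ p q → q :- p :+ p := q) refl p q) (ℚ.+-monoˡ-≤ p h)

0<q-p⇒p<q : ∀ {p q} → 0ℚ ℚ.< q ⊖ p → p ℚ.< q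
0<q-p⇒p<q {p} {q} h = subst₂ ℚ._<_ (ℚ.+-identityˡ p)
  (solve 2 (λ p q → q :- p :+ p := q) refl p q) (ℚ.+-monoˡ-< p h)

infixl 6 _+≤_ _+<_
_+≤_ : ∀ {p q} → 0ℚ ℚ.≤ p → 0ℚ ℚ.≤ q → 0ℚ ℚ.≤ p ⊕ q
_+≤_ = ℚ.+-mono-≤

_+<_ : ∀ {p q} → 0ℚ ℚ.< p → 0ℚ ℚ.≤ q → 0ℚ ℚ.< p ⊕ q
_+<_ = ℚ.+-mono-<-≤

infixl 7 _*≤_
_*≤_ : ∀ {p q} → 0ℚ ℚ.≤ p → 0ℚ ℚ.≤ q → 0ℚ ℚ.≤ p · q
_*≤_ {p} {q} 0≤p 0≤q = ℚ.nonNegative⁻¹ _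
  {{ℚ.nonNeg*nonNeg⇒nonNeg p {{ℚ.nonNegative 0≤p}} q {{ℚ.nonNegative 0≤q}}}}

*-pos : ∀ {p q} → 0ℚ ℚ.< p → 0ℚ ℚ.< q → 0ℚ ℚ.< p · q
*-pos {p} {q} 0<p 0<q = ℚ.positive⁻¹ _
  {{ℚ.pos*pos⇒pos p {{ℚ.positive 0<p}} q {{ℚ.positive 0<q}}}}

-- Common form of the contradictions below: a positive combination of the hypotheses is reduced by
-- the ring solver to a constant `c`, and `c ≤ 0` is decided by evaluation.
positive-≢ : ∀ {p} c {c≤0 : True (c ℚ.≤? 0ℚ)} → 0ℚ ℚ.< p → p ≡ c → ⊥
positive-≢ c {c≤0} 0<p refl = ℚ.<-irrefl refl (ℚ.<-≤-trans 0<p (toWitness c≤0))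

∣p∣≤q : ∀ {p q} → ℚ.- q ℚ.≤ p → p ℚ.≤ q → ∣ p ∣ ℚ.≤ q
∣p∣≤q {p} {q} l u with ℚ.∣p∣≡p∨∣p∣≡-p p
... | inj₁ eq = subst (ℚ._≤ q) (sym eq) u
... | inj₂ eq = subst₂ ℚ._≤_ (sym eq) (solve 1 (λ q → :- (:- q) := q) refl q) (ℚ.neg-antimono-≤ l)

p≤∣p∣ : ∀ p → p ℚ.≤ ∣ p ∣
p≤∣p∣ p with ℚ.≤-total 0ℚ p
... | inj₁ 0≤p = ℚ.≤-reflexive (sym (ℚ.0≤p⇒∣p∣≡p 0≤p))
... | inj₂ p≤0 = ℚ.≤-trans p≤0 (ℚ.0≤∣p∣ p)

-p≤∣p∣ : ∀ p → ℚ.- p ℚ.≤ ∣ p ∣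
-p≤∣p∣ p = subst (ℚ.- p ℚ.≤_) (ℚ.∣-p∣≡∣p∣ p) (p≤∣p∣ (ℚ.- p))

∣c*p∣≤c*q : ∀ {c p q} → 0ℚ ℚ.≤ c → ∣ p ∣ ℚ.≤ q → ∣ c · p ∣ ℚ.≤ c · q
∣c*p∣≤c*q {c} {p} {q} 0≤c h = subst (ℚ._≤ c · q)
  (sym (trans (ℚ.∣p*q∣≡∣p∣*∣q∣ c p) (cong (_· ∣ p ∣) (ℚ.0≤p⇒∣p∣≡p 0≤c))))
  (ℚ.*-monoˡ-≤-nonNeg c {{ℚ.nonNegative 0≤c}} h)

∣p+q+r∣≤ : ∀ {p q r P Q R} → ∣ p ∣ ℚ.≤ P → ∣ q ∣ ℚ.≤ Q → ∣ r ∣ ℚ.≤ R →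
           ∣ p ⊕ q ⊕ r ∣ ℚ.≤ P ⊕ Q ⊕ R
∣p+q+r∣≤ {p} {q} {r} hp hq hr = ℚ.≤-trans (ℚ.∣p+q∣≤∣p∣+∣q∣ (p ⊕ q) r)
  (ℚ.+-mono-≤ (ℚ.≤-trans (ℚ.∣p+q∣≤∣p∣+∣q∣ p q) (ℚ.+-mono-≤ hp hq)) hr)

-- Periodic sequences

module _ {A : Set} {f : ℕ → A} (p : ℕ) .{{_ : ℕ.NonZero p}}
         (f-periodic : ∀ n → f (n ℕ.+ p) ≡ f n) where

  periodic-* : ∀ k n → f (n ℕ.+ k ℕ.* p) ≡ f n
  periodic-* zero    n = cong f (ℕ.+-identityʳ n)
  periodic-* (suc k) n = trans (cong f (sym (ℕ.+-assoc n p (k ℕ.* p))))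
    (trans (periodic-* k (n ℕ.+ p)) (f-periodic n))

  periodic-% : ∀ n → f n ≡ f (n % p)
  periodic-% n = trans (cong f (m≡m%n+[m/n]*n n p)) (periodic-* (n ℕ./ p) (n % p))

-- One period carries all values. The maximum comes with an index attaining it, where the recurrence
-- can then be applied.
periodic-max : ∀ {f : ℕ → ℚ} p .{{_ : ℕ.NonZero p}} → (∀ n → f (n ℕ.+ p) ≡ f n) →
               ∃ λ m → ∀ n → f n ℚ.≤ f m
periodic-max {f} p f-periodic = argmax f 0 (upTo p) , λ n →
  subst (ℚ._≤ f (argmax f 0 (upTo p))) (sym (periodic-% p f-periodic n))
    (All.lookup (f[xs]≤f[argmax] {f = f} 0 (upTo p)) (∈-upTo⁺ (m%n<n n p)))
  where open Data.List.Extrema (DecTotalOrder.totalOrder ℚ.≤-decTotalOrder) using (argmax; f[xs]≤f[argmax])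

-- Integers as rationals

ι : ℤ → ℚ
ι i = i ℚ./ 1

private
  ι≃ : ∀ i → toℚᵘ (ι i) ℚᵘ.≃ mkℚᵘ i 0
  ι≃ i = ℚ.toℚᵘ-fromℚᵘ (mkℚᵘ i 0)

ι-+ : ∀ i j → ι (i ℤ.+ j) ≡ ι i ⊕ ι j
ι-+ i j = ℚ.toℚᵘ-injective (let open ℚᵘ.≤-Reasoning in begin-equality
  toℚᵘ (ι (i ℤ.+ j))              ≃⟨ ι≃ (i ℤ.+ j) ⟩
  mkℚᵘ (i ℤ.+ j) 0                ≃⟨ *≡* (cong (ℤ._* + 1)
                                       (sym (cong₂ ℤ._+_ (ℤ.*-identityʳ i) (ℤ.*-identityʳ j)))) ⟩
  mkℚᵘ i 0 ℚᵘ.+ mkℚᵘ j 0          ≃⟨ ℚᵘ.+-cong (ι≃ i) (ι≃ j) ⟨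
  toℚᵘ (ι i) ℚᵘ.+ toℚᵘ (ι j)      ≃⟨ ℚ.toℚᵘ-homo-+ (ι i) (ι j) ⟨
  toℚᵘ (ι i ⊕ ι j)                ∎)

ι-neg : ∀ i → ι (ℤ.- i) ≡ ℚ.- ι i
ι-neg i = ℚ.toℚᵘ-injective (let open ℚᵘ.≤-Reasoning in begin-equality
  toℚᵘ (ι (ℤ.- i))      ≃⟨ ι≃ (ℤ.- i) ⟩
  ℚᵘ.- mkℚᵘ i 0         ≃⟨ ℚᵘ.-‿cong (ι≃ i) ⟨
  ℚᵘ.- toℚᵘ (ι i)       ≃⟨ ℚ.toℚᵘ-homo‿- (ι i) ⟨
  toℚᵘ (ℚ.- ι i)        ∎)

ι-cancel-< : ∀ {i j} → ι i ℚ.< ι j → i ℤ.< j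
ι-cancel-< {i} {j} h
  with ℚᵘ.<-respˡ-≃ (ι≃ i) (ℚᵘ.<-respʳ-≃ (ι≃ j) (ℚ.toℚᵘ-mono-< h))
... | *<* i<j = subst₂ ℤ._<_ (ℤ.*-identityʳ i) (ℤ.*-identityʳ j) i<j

-- Indexed by the value, so that matching on a constructor turns a rational variable into a literal.
data Sign : ℚ → Set where
  minus : Sign (ℚ.- 1ℚ)
  null  : Sign 0ℚ
  plus  : Sign 1ℚ

-1≤sign : ∀ {x} → Sign x → ℚ.- 1ℚ ℚ.≤ x
-1≤sign minus = toWitness {a? = ℚ.- 1ℚ ℚ.≤? ℚ.- 1ℚ} _
-1≤sign null  = toWitness {a? = ℚ.- 1ℚ ℚ.≤? 0ℚ} _
-1≤sign plus  = toWitness {a? = ℚ.- 1ℚ ℚ.≤? 1ℚ} _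

sign≤1 : ∀ {x} → Sign x → x ℚ.≤ 1ℚ
sign≤1 minus = toWitness {a? = ℚ.- 1ℚ ℚ.≤? 1ℚ} _
sign≤1 null  = toWitness {a? = 0ℚ ℚ.≤? 1ℚ} _
sign≤1 plus  = toWitness {a? = 1ℚ ℚ.≤? 1ℚ} _

ι-sign : ∀ i → ℚ.- 2ℚ ℚ.< ι i → ι i ℚ.< 2ℚ → Sign (ι i)
ι-sign (+ 0)             _ _ = null
ι-sign (+ 1)             _ _ = plus
ι-sign (+ suc (suc n))   _ h with ι-cancel-< {+ suc (suc n)} {+ 2} h
... | ℤ.+<+ (ℕ.s≤s (ℕ.s≤s ()))
ι-sign -[1+ 0 ]          _ _ = minus
ι-sign -[1+ suc n ]      h _ with ι-cancel-< { -[1+ 1 ]} { -[1+ suc n ]} h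
... | ℤ.-<- (ℕ.s≤s ())

ι-null : ∀ i → ℚ.- 1ℚ ℚ.< ι i → ι i ℚ.< 1ℚ → i ≡ 0ℤ
ι-null (+ 0)       _ _ = refl
ι-null (+ suc n)   _ h with ι-cancel-< {+ suc n} {+ 1} h
... | ℤ.+<+ (ℕ.s≤s ())
ι-null -[1+ n ]    h _ with ι-cancel-< { -[1+ 0 ]} { -[1+ n ]} h
... | ℤ.-<- ()

-- The recurrence over ℚ

-- In these parameters `r₀` is `q ⊕ ε` and `r₁` is `q ⊕ 1ℚ`.
module Recurrence (q ε : ℚ) (x : ℕ → ℚ) where

  e d u : ℕ → ℚ
  e n = (q ⊕ ε) · x n ⊕ (q ⊕ 1ℚ) · x (1 ℕ.+ n) ⊕ x (2 ℕ.+ n)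
  d n = x n ⊕ x (1 ℕ.+ n)
  u n = x n ⊕ d n

  -- The minus sign is attached to `d`, here as to `u` in `u-step`, so that the coefficients in
  -- front are nonnegative and `∣c*p∣≤c*q` applies.
  d-step : ∀ n → (q ⊕ ε) · d n ≡
                 e n ⊕ ε · u (1 ℕ.+ n) ⊕ (1ℚ ⊕ ε) · (ℚ.- d (1 ℕ.+ n))
  d-step n = solve 5 (λ q ε a b c →
      (q :+ ε) :* (a :+ b) :=
      ((q :+ ε) :* a :+ (q :+ con 1ℚ) :* b :+ c) :+ ε :* (b :+ (b :+ c))
        :+ (con 1ℚ :+ ε) :* (:- (b :+ c)))
    refl q ε (x n) (x (1 ℕ.+ n)) (x (2 ℕ.+ n))

  u-step : ∀ n → (q ⊕ ε) · u n ≡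
                 2ℚ · e n ⊕ (q ⊖ ε) · (ℚ.- u (1 ℕ.+ n)) ⊕ (q ⊖ 2ℚ ⊖ ε) · d (1 ℕ.+ n)
  u-step n = solve 5 (λ q ε a b c →
      (q :+ ε) :* (a :+ (a :+ b)) :=
      con 2ℚ :* ((q :+ ε) :* a :+ (q :+ con 1ℚ) :* b :+ c)
        :+ (q :- ε) :* (:- (b :+ (b :+ c))) :+ (q :- con 2ℚ :- ε) :* (b :+ c))
    refl q ε (x n) (x (1 ℕ.+ n)) (x (2 ℕ.+ n))

  -- Adding two consecutive constraints leaves a condition on `d` alone.
  d-sum : ∀ n → (q ⊕ ε) · d n ⊕ (q ⊕ 1ℚ) · d (1 ℕ.+ n) ⊕ d (2 ℕ.+ n) ≡ e n ⊕ e (1 ℕ.+ n)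
  d-sum n = solve 6 (λ q ε a b c f →
      (q :+ ε) :* (a :+ b) :+ (q :+ con 1ℚ) :* (b :+ c) :+ (c :+ f) :=
      ((q :+ ε) :* a :+ (q :+ con 1ℚ) :* b :+ c) :+ ((q :+ ε) :* b :+ (q :+ con 1ℚ) :* c :+ f))
    refl q ε (x n) (x (1 ℕ.+ n)) (x (2 ℕ.+ n)) (x (3 ℕ.+ n))

-- Comparing the maxima of `d` and `u` over a period

module _ {q ε : ℚ} (0<ε : 0ℚ ℚ.< ε) (ε≤1 : ε ℚ.≤ 1ℚ) (6+ε<3q : 6ℚ ⊕ ε ℚ.< 3ℚ · q) where

  private
    2<q : 2ℚ ℚ.< q
    2<q = ℚ.*-cancelˡ-<-nonNeg 3ℚ (0<q-p⇒p<q (subst (0ℚ ℚ.<_)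
      (solve 2 (λ q ε → con 3ℚ :* q :- (con 6ℚ :+ ε) :+ ε := con 3ℚ :* q :- con 3ℚ :* con 2ℚ) refl q ε)
      (p<q⇒0<q-p 6+ε<3q +< ℚ.<⇒≤ 0<ε)))

    0<q-2 : 0ℚ ℚ.< q ⊖ 2ℚ
    0<q-2 = p<q⇒0<q-p 2<q

    0≤q-ε : 0ℚ ℚ.≤ q ⊖ ε
    0≤q-ε = subst (0ℚ ℚ.≤_)
      (solve 2 (λ q ε → q :- con 2ℚ :+ (con 1ℚ :- ε) :+ con 1ℚ := q :- ε) refl q ε)
      (ℚ.<⇒≤ 0<q-2 +≤ p≤q⇒0≤q-p ε≤1 +≤ ℚ.<⇒≤ (ℚ.positive⁻¹ 1ℚ))

    0≤q+ε : 0ℚ ℚ.≤ q ⊕ ε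
    0≤q+ε = subst (0ℚ ℚ.≤_)
      (solve 2 (λ q ε → q :- ε :+ ε :+ ε := q :+ ε) refl q ε)
      (0≤q-ε +≤ ℚ.<⇒≤ 0<ε +≤ ℚ.<⇒≤ 0<ε)

    0≤1+ε : 0ℚ ℚ.≤ 1ℚ ⊕ ε
    0≤1+ε = ℚ.<⇒≤ (ℚ.positive⁻¹ 1ℚ) +≤ ℚ.<⇒≤ 0<ε

    -- For `q ⊖ 2ℚ ⊖ ε` of positive sign this amounts to `2 < q + ε`, for negative sign to
    -- `6 + ε < 3 q`.
    ∣q-2-ε∣+2<2[q-1] : ∣ q ⊖ 2ℚ ⊖ ε ∣ ⊕ 2ℚ ℚ.< 2ℚ · (q ⊖ 1ℚ)
    ∣q-2-ε∣+2<2[q-1] with ℚ.∣p∣≡p∨∣p∣≡-p (q ⊖ 2ℚ ⊖ ε)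
    ... | inj₁ eq = 0<q-p⇒p<q (subst (0ℚ ℚ.<_)
      (trans (solve 2 (λ q ε → q :- con 2ℚ :+ ε :=
                con 2ℚ :* (q :- con 1ℚ) :- ((q :- con 2ℚ :- ε) :+ con 2ℚ)) refl q ε)
             (cong (λ c → 2ℚ · (q ⊖ 1ℚ) ⊖ (c ⊕ 2ℚ)) (sym eq)))
      (0<q-2 +< ℚ.<⇒≤ 0<ε))
    ... | inj₂ eq = 0<q-p⇒p<q (subst (0ℚ ℚ.<_)
      (trans (solve 2 (λ q ε → con 3ℚ :* q :- (con 6ℚ :+ ε) :=
                con 2ℚ :* (q :- con 1ℚ) :- (:- (q :- con 2ℚ :- ε) :+ con 2ℚ)) refl q ε)
             (cong (λ c → 2ℚ · (q ⊖ 1ℚ) ⊖ (c ⊕ 2ℚ)) (sym eq)))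
      (p<q⇒0<q-p 6+ε<3q))

  module _ {x : ℕ → ℚ} where

    open Recurrence q ε x

    ∣d∣<2 : ∀ p .{{_ : ℕ.NonZero p}} → (∀ n → x (n ℕ.+ p) ≡ x n) →
            (∀ n → ∣ e n ∣ ℚ.≤ 1ℚ) → ∀ n → ∣ d n ∣ ℚ.< 2ℚ
    ∣d∣<2 p x-periodic ∣e∣≤1 n = ℚ.≤-<-trans (proj₂ d-max n) D<2
      where
      d-periodic : ∀ n → d (n ℕ.+ p) ≡ d n
      d-periodic n = cong₂ _⊕_ (x-periodic n) (x-periodic (1 ℕ.+ n))

      d-max = periodic-max {λ n → ∣ d n ∣} p λ n → cong ∣_∣ (d-periodic n)
      u-max = periodic-max {λ n → ∣ u n ∣} p λ n →
        cong ∣_∣ (cong₂ _⊕_ (x-periodic n) (d-periodic n))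
      k = proj₁ d-max
      l = proj₁ u-max
      D = ∣ d k ∣
      U = ∣ u l ∣
      c = ∣ q ⊖ 2ℚ ⊖ ε ∣

      -d≤D : ∀ n → ∣ ℚ.- d n ∣ ℚ.≤ D
      -d≤D n = subst (ℚ._≤ D) (sym (ℚ.∣-p∣≡∣p∣ (d n))) (proj₂ d-max n)

      -u≤U : ∀ n → ∣ ℚ.- u n ∣ ℚ.≤ U
      -u≤U n = subst (ℚ._≤ U) (sym (ℚ.∣-p∣≡∣p∣ (u n))) (proj₂ u-max n)

      D-bound : (q ⊕ ε) · D ℚ.≤ 1ℚ ⊕ ε · U ⊕ (1ℚ ⊕ ε) · D
      D-bound = subst (ℚ._≤ 1ℚ ⊕ ε · U ⊕ (1ℚ ⊕ ε) · D)
        (trans (cong ∣_∣ (sym (d-step k)))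
          (trans (ℚ.∣p*q∣≡∣p∣*∣q∣ (q ⊕ ε) (d k)) (cong (_· D) (ℚ.0≤p⇒∣p∣≡p 0≤q+ε))))
        (∣p+q+r∣≤ {e k} {ε · u (1 ℕ.+ k)} {(1ℚ ⊕ ε) · (ℚ.- d (1 ℕ.+ k))} (∣e∣≤1 k)
          (∣c*p∣≤c*q {ε} {u (1 ℕ.+ k)} (ℚ.<⇒≤ 0<ε) (proj₂ u-max (1 ℕ.+ k)))
          (∣c*p∣≤c*q {1ℚ ⊕ ε} {ℚ.- d (1 ℕ.+ k)} 0≤1+ε (-d≤D (1 ℕ.+ k))))

      -- The coefficients of `U` differ by `2 ε`, so this says `2 ε U ≤ 2 + c D`, which eliminates
      -- `U` from twice `D-bound`, that is from `2 (q − 1) D ≤ 2 + 2 ε U`.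
      U-bound : (q ⊕ ε) · U ℚ.≤ 2ℚ · 1ℚ ⊕ (q ⊖ ε) · U ⊕ c · D
      U-bound = subst (ℚ._≤ 2ℚ · 1ℚ ⊕ (q ⊖ ε) · U ⊕ c · D)
        (trans (cong ∣_∣ (sym (u-step l)))
          (trans (ℚ.∣p*q∣≡∣p∣*∣q∣ (q ⊕ ε) (u l)) (cong (_· U) (ℚ.0≤p⇒∣p∣≡p 0≤q+ε))))
        (∣p+q+r∣≤ {2ℚ · e l} {(q ⊖ ε) · (ℚ.- u (1 ℕ.+ l))} {(q ⊖ 2ℚ ⊖ ε) · d (1 ℕ.+ l)}
          (∣c*p∣≤c*q {2ℚ} {e l} (ℚ.<⇒≤ (ℚ.positive⁻¹ 2ℚ)) (∣e∣≤1 l))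
          (∣c*p∣≤c*q {q ⊖ ε} {ℚ.- u (1 ℕ.+ l)} 0≤q-ε (-u≤U (1 ℕ.+ l)))
          (subst (ℚ._≤ c · D) (sym (ℚ.∣p*q∣≡∣p∣*∣q∣ (q ⊖ 2ℚ ⊖ ε) (d (1 ℕ.+ l))))
            (ℚ.*-monoˡ-≤-nonNeg c {{ℚ.nonNegative (ℚ.0≤∣p∣ (q ⊖ 2ℚ ⊖ ε))}}
              (proj₂ d-max (1 ℕ.+ l)))))

      -- If 2 ≤ D then (c + 2) D < 2 (q − 1) D ≤ 4 + c D, whence D < 2.
      D<2 : D ℚ.< 2ℚ
      D<2 = ℚ.≰⇒> λ 2≤D → positive-≢ 0ℚ
        (*-pos (p<q⇒0<q-p ∣q-2-ε∣+2<2[q-1]) (ℚ.<-≤-trans (ℚ.positive⁻¹ 2ℚ) 2≤D)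
          +< ℚ.<⇒≤ (ℚ.positive⁻¹ 2ℚ) *≤ p≤q⇒0≤q-p 2≤D
          +< ℚ.<⇒≤ (ℚ.positive⁻¹ 2ℚ) *≤ p≤q⇒0≤q-p D-bound
          +< p≤q⇒0≤q-p U-bound)
        (solve 5 (λ q ε D U c →
            (con 2ℚ :* (q :- con 1ℚ) :- (c :+ con 2ℚ)) :* D
              :+ con 2ℚ :* (D :- con 2ℚ)
              :+ con 2ℚ :* ((con 1ℚ :+ ε :* U :+ (con 1ℚ :+ ε) :* D) :- (q :+ ε) :* D)
              :+ ((con 2ℚ :* con 1ℚ :+ (q :- ε) :* U :+ c :* D) :- (q :+ ε) :* U)
            := con 0ℚ) refl q ε D U c)

  -- Excluding the nonzero values of `d`

  module _ {η : ℚ} (0<η : 0ℚ ℚ.< η) (4η≤ε : 4ℚ · η ℚ.≤ ε) where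

    private
      0≤η = ℚ.<⇒≤ 0<η
      0≤2η = ℚ.<⇒≤ (ℚ.positive⁻¹ 2ℚ) *≤ 0≤η
      0≤ε-4η = p≤q⇒0≤q-p 4η≤ε

    -- The constraints `−η ≤ e < 1` at two consecutive indices, added up as in `d-sum`.
    Admissible : ℚ → ℚ → ℚ → Set
    Admissible d₀ d₁ d₂ = let s = (q ⊕ ε) · d₀ ⊕ (q ⊕ 1ℚ) · d₁ ⊕ d₂ in
      ℚ.- (2ℚ · η) ℚ.≤ s × s ℚ.< 2ℚ

    private
      ¬1,1 : ∀ {d₂} → Sign d₂ → Admissible 1ℚ 1ℚ d₂ → ⊥
      ¬1,1 {d₂} s (_ , <2) = positive-≢ (ℚ.- 2ℚ)
        (p<q⇒0<q-p <2 +< p≤q⇒0≤q-p (-1≤sign s) +< ℚ.<⇒≤ 0<q-2 +< ℚ.<⇒≤ 0<q-2 +< ℚ.<⇒≤ 0<ε)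
        (solve 3 (λ q ε d₂ →
          (con 2ℚ :- ((q :+ ε) :* con 1ℚ :+ (q :+ con 1ℚ) :* con 1ℚ :+ d₂))
            :+ (d₂ :- con (ℚ.- 1ℚ)) :+ (q :- con 2ℚ) :+ (q :- con 2ℚ) :+ ε
          := con (ℚ.- 2ℚ)) refl q ε d₂)

      ¬-1,-1 : ∀ {d₂} → Sign d₂ → Admissible (ℚ.- 1ℚ) (ℚ.- 1ℚ) d₂ → ⊥
      ¬-1,-1 {d₂} s (-2η≤ , _) = positive-≢ (ℚ.- 4ℚ)
        (0<q-2 +< ℚ.<⇒≤ 0<q-2 +< p≤q⇒0≤q-p -2η≤ +< p≤q⇒0≤q-p (sign≤1 s) +< 0≤ε-4η +< 0≤2η)
        (solve 4 (λ q ε η d₂ →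
          (q :- con 2ℚ) :+ (q :- con 2ℚ)
            :+ (((q :+ ε) :* con (ℚ.- 1ℚ) :+ (q :+ con 1ℚ) :* con (ℚ.- 1ℚ) :+ d₂) :- (:- (con 2ℚ :* η)))
            :+ (con 1ℚ :- d₂) :+ (ε :- con 4ℚ :* η) :+ con 2ℚ :* η
          := con (ℚ.- 4ℚ)) refl q ε η d₂)

      ¬-1,0 : ∀ {d₂} → Sign d₂ → Admissible (ℚ.- 1ℚ) 0ℚ d₂ → ⊥
      ¬-1,0 {d₂} s (-2η≤ , _) = positive-≢ (ℚ.- 1ℚ)
        (0<q-2 +< p≤q⇒0≤q-p -2η≤ +< p≤q⇒0≤q-p (sign≤1 s) +< 0≤ε-4η +< 0≤2η)
        (solve 4 (λ q ε η d₂ →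
          (q :- con 2ℚ)
            :+ (((q :+ ε) :* con (ℚ.- 1ℚ) :+ (q :+ con 1ℚ) :* con 0ℚ :+ d₂) :- (:- (con 2ℚ :* η)))
            :+ (con 1ℚ :- d₂) :+ (ε :- con 4ℚ :* η) :+ con 2ℚ :* η
          := con (ℚ.- 1ℚ)) refl q ε η d₂)

      -- Here `q` cancels and the sum is exactly `−ε`, so the exclusion rests on `2 η < ε`, which
      -- `4η≤ε` supplies.
      ¬-1,1,-1 : Admissible (ℚ.- 1ℚ) 1ℚ (ℚ.- 1ℚ) → ⊥
      ¬-1,1,-1 (-2η≤ , _) = positive-≢ 0ℚ
        (*-pos (ℚ.positive⁻¹ 2ℚ) 0<η +< p≤q⇒0≤q-p -2η≤ +< 0≤ε-4η)
        (solve 3 (λ q ε η →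
          con 2ℚ :* η
            :+ (((q :+ ε) :* con (ℚ.- 1ℚ) :+ (q :+ con 1ℚ) :* con 1ℚ :+ con (ℚ.- 1ℚ))
                 :- (:- (con 2ℚ :* η)))
            :+ (ε :- con 4ℚ :* η)
          := con 0ℚ) refl q ε η)

      ¬0,-1 : ∀ {d₂} → Sign d₂ → Admissible 0ℚ (ℚ.- 1ℚ) d₂ → ⊥
      ¬0,-1 {d₂} s (-2η≤ , _) = positive-≢ (ℚ.- 1ℚ)
        (0<q-2 +< p≤q⇒0≤q-p -2η≤ +< p≤q⇒0≤q-p (sign≤1 s) +< p≤q⇒0≤q-p ε≤1 +< 0≤ε-4η +< 0≤2η)
        (solve 4 (λ q ε η d₂ →
          (q :- con 2ℚ)
            :+ (((q :+ ε) :* con 0ℚ :+ (q :+ con 1ℚ) :* con (ℚ.- 1ℚ) :+ d₂) :- (:- (con 2ℚ :* η)))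
            :+ (con 1ℚ :- d₂) :+ (con 1ℚ :- ε) :+ (ε :- con 4ℚ :* η) :+ con 2ℚ :* η
          := con (ℚ.- 1ℚ)) refl q ε η d₂)

      ¬1,0,0≤ : ∀ {d₂} → 0ℚ ℚ.≤ d₂ → Admissible 1ℚ 0ℚ d₂ → ⊥
      ¬1,0,0≤ {d₂} 0≤d₂ (_ , <2) = positive-≢ 0ℚ
        (p<q⇒0<q-p <2 +< 0≤d₂ +< ℚ.<⇒≤ 0<q-2 +< ℚ.<⇒≤ 0<ε)
        (solve 3 (λ q ε d₂ →
          (con 2ℚ :- ((q :+ ε) :* con 1ℚ :+ (q :+ con 1ℚ) :* con 0ℚ :+ d₂))
            :+ d₂ :+ (q :- con 2ℚ) :+ ε
          := con 0ℚ) refl q ε d₂)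

      -- For `d₂ ≥ 0` the sum is at least `q + ε > 2`. For `d₂ = −1` the first window alone may be
      -- admissible, but the next one starts with 0, -1.
      ¬1,0 : ∀ {d₂ d₃} → Sign d₂ → Sign d₃ → Admissible 1ℚ 0ℚ d₂ → Admissible 0ℚ d₂ d₃ → ⊥
      ¬1,0 minus s₃ _ h = ¬0,-1 s₃ h
      ¬1,0 null  _  h _ = ¬1,0,0≤ ℚ.≤-refl h
      ¬1,0 plus  _  h _ = ¬1,0,0≤ (ℚ.<⇒≤ (ℚ.positive⁻¹ 1ℚ)) h

    module _ {d : ℕ → ℚ} (d-sign : ∀ n → Sign (d n))
             (d-admissible : ∀ n → Admissible (d n) (d (1 ℕ.+ n)) (d (2 ℕ.+ n))) where

      private
        -- A value -1 can only be followed by 1. After -1, 1 the value -1 is excluded by `¬-1,1,-1`,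
        -- while 0 and 1 lead to the forbidden beginnings 1, 0 and 1, 1.
        ¬-1 : ∀ n → d n ≢ ℚ.- 1ℚ
        ¬-1 n d₀≡-1
          -- Abstracting the values together with their signs makes `d₀≡-1` absurd unless the first
          -- sign is `minus`.
          with d n | d (1 ℕ.+ n) | d (2 ℕ.+ n) | d (3 ℕ.+ n) | d (4 ℕ.+ n)
             | d-sign n | d-sign (1 ℕ.+ n) | d-sign (2 ℕ.+ n) | d-sign (3 ℕ.+ n) | d-sign (4 ℕ.+ n)
             | d-admissible n | d-admissible (1 ℕ.+ n) | d-admissible (2 ℕ.+ n)
        ... | _ | _ | _ | _ | _ | minus | minus | s₂    | _  | _  | h | _  | _  = ¬-1,-1 s₂ h
        ... | _ | _ | _ | _ | _ | minus | null  | s₂    | _  | _  | h | _  | _  = ¬-1,0 s₂ h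
        ... | _ | _ | _ | _ | _ | minus | plus  | minus | _  | _  | h | _  | _  = ¬-1,1,-1 h
        ... | _ | _ | _ | _ | _ | minus | plus  | null  | s₃ | s₄ | _ | h₁ | h₂ = ¬1,0 s₃ s₄ h₁ h₂
        ... | _ | _ | _ | _ | _ | minus | plus  | plus  | s₃ | _  | _ | h₁ | _  = ¬1,1 s₃ h₁

        -- With -1 already ruled out everywhere, a value 1 could only be followed by 0 or 1.
        ¬1 : ∀ n → d n ≢ 1ℚ
        ¬1 n d₀≡1
          with d n | d (1 ℕ.+ n) | d (2 ℕ.+ n) | d (3 ℕ.+ n)
             | d-sign n | d-sign (1 ℕ.+ n) | d-sign (2 ℕ.+ n) | d-sign (3 ℕ.+ n)
             | d-admissible n | d-admissible (1 ℕ.+ n) | ¬-1 (1 ℕ.+ n)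
        ... | _ | _ | _ | _ | plus | minus | _  | _  | _ | _  | ¬p = ¬p refl
        ... | _ | _ | _ | _ | plus | null  | s₂ | s₃ | h | h₁ | _  = ¬1,0 s₂ s₃ h h₁
        ... | _ | _ | _ | _ | plus | plus  | s₂ | _  | h | _  | _  = ¬1,1 s₂ h

      d≡0 : ∀ n → d n ≡ 0ℚ
      d≡0 n with d n | d-sign n | ¬-1 n | ¬1 n
      ... | _ | minus | ¬p | _  = ⊥-elim (¬p refl)
      ... | _ | null  | _  | _  = refl
      ... | _ | plus  | _  | ¬p = ⊥-elim (¬p refl)

    orbit-null : ∀ (b : ℕ → ℤ) p .{{_ : ℕ.NonZero p}} → (∀ n → b (n ℕ.+ p) ≡ b n) →
                 (let open Recurrence q ε (λ n → ι (b n))) →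
                 (∀ n → ℚ.- η ℚ.≤ e n × e n ℚ.< 1ℚ) → ∀ n → b n ≡ 0ℤ
    orbit-null b p b-periodic e-bounds n = ι-null (b n) (-1<x n) x<1
      where
      x : ℕ → ℚ
      x n = ι (b n)
      open Recurrence q ε x

      -1≤-η : ℚ.- 1ℚ ℚ.≤ ℚ.- η
      -1≤-η = 0≤q-p⇒p≤q (subst (0ℚ ℚ.≤_)
        (solve 2 (λ ε η → (ε :- con 4ℚ :* η) :+ (con 1ℚ :- ε) :+ con 2ℚ :* η :+ η :=
                          :- η :- con (ℚ.- 1ℚ)) refl ε η)
        (0≤ε-4η +≤ p≤q⇒0≤q-p ε≤1 +≤ 0≤2η +≤ 0≤η))

      ∣d∣<2′ : ∀ n → ∣ d n ∣ ℚ.< 2ℚ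
      ∣d∣<2′ = ∣d∣<2 p (λ n → cong ι (b-periodic n)) λ n → let lower , upper = e-bounds n in
        ∣p∣≤q (ℚ.≤-trans -1≤-η lower) (ℚ.<⇒≤ upper)

      d-sign : ∀ n → Sign (d n)
      d-sign n = subst Sign d≡ (ι-sign (b n ℤ.+ b (1 ℕ.+ n))
        (subst (ℚ.- 2ℚ ℚ.<_) (trans (solve 1 (λ y → :- (:- y) := y) refl (d n)) (sym d≡))
          (ℚ.neg-antimono-< (ℚ.≤-<-trans (-p≤∣p∣ (d n)) (∣d∣<2′ n))))
        (subst (ℚ._< 2ℚ) (sym d≡) (ℚ.≤-<-trans (p≤∣p∣ (d n)) (∣d∣<2′ n))))
        where d≡ = ι-+ (b n) (b (1 ℕ.+ n))

      d-admissible : ∀ n → Admissible (d n) (d (1 ℕ.+ n)) (d (2 ℕ.+ n))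
      d-admissible n =
        subst₂ ℚ._≤_ (solve 1 (λ η → :- η :+ :- η := :- (con 2ℚ :* η)) refl η) (sym (d-sum n))
          (ℚ.+-mono-≤ (proj₁ (e-bounds n)) (proj₁ (e-bounds (1 ℕ.+ n)))) ,
        subst (ℚ._< 2ℚ) (sym (d-sum n))
          (ℚ.+-mono-< (proj₂ (e-bounds n)) (proj₂ (e-bounds (1 ℕ.+ n))))

      d-null : ∀ n → d n ≡ 0ℚ
      d-null = d≡0 d-sign d-admissible

      e≡εx : ∀ n → e n ≡ ε · x n
      e≡εx n = trans
        (solve 5 (λ q ε a b c →
            (q :+ ε) :* a :+ (q :+ con 1ℚ) :* b :+ c := ε :* a :+ q :* (a :+ b) :+ (b :+ c))
          refl q ε (x n) (x (1 ℕ.+ n)) (x (2 ℕ.+ n)))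
        (trans (cong₂ (λ v w → ε · x n ⊕ q · v ⊕ w) (d-null n) (d-null (1 ℕ.+ n)))
          (solve 3 (λ q ε a → ε :* a :+ q :* con 0ℚ :+ con 0ℚ := ε :* a) refl q ε (x n)))

      -- From `ε x ≥ −η` and `4 η ≤ ε`; for an integer, exceeding -1 is all that is wanted.
      -1<x : ∀ n → ℚ.- 1ℚ ℚ.< x n
      -1<x n = ℚ.*-cancelˡ-<-nonNeg ε {{ℚ.nonNegative (ℚ.<⇒≤ 0<ε)}} (0<q-p⇒p<q (subst (0ℚ ℚ.<_)
        (solve 3 (λ ε η a → η :+ (ε :- con 4ℚ :* η) :+ con 2ℚ :* η :+ (ε :* a :- :- η) :=
                            ε :* a :- ε :* con (ℚ.- 1ℚ)) refl ε η (x n))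
        (0<η +< 0≤ε-4η +< 0≤2η +<
          p≤q⇒0≤q-p (subst (ℚ.- η ℚ.≤_) (e≡εx n) (proj₁ (e-bounds n))))))

      x≡-x′ : x n ≡ ℚ.- x (1 ℕ.+ n)
      x≡-x′ = trans (solve 2 (λ a b → a := (a :+ b) :- b) refl (x n) (x (1 ℕ.+ n)))
        (trans (cong (_⊖ x (1 ℕ.+ n)) (d-null n)) (ℚ.+-identityˡ _))

      -- The bound `e n < 1` would give only `x n < 1/ε`; the alternation of signs transfers the
      -- lower bound at the next index instead.
      x<1 : x n ℚ.< 1ℚ
      x<1 = subst (ℚ._< 1ℚ) (sym x≡-x′) (ℚ.neg-antimono-< (-1<x (1 ℕ.+ n)))

-- Here s₀, s₁, t approximate r₀, r₁, √5.
approximate-orbit-null : ∀ s₀ s₁ t δ → 0ℚ ℚ.< δ →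
  ℚ.- 1ℚ ⊕ δ ℚ.≤ s₀ ⊖ s₁ → s₀ ⊖ s₁ ℚ.≤ -½ ⊕ 1/100 →
  1ℚ ⊕ t ℚ.≤ s₁ ⊕ 1/100 → 11/5 ℚ.≤ t →
  ∀ (b : ℕ → ℤ) p .{{_ : ℕ.NonZero p}} → (∀ n → b (n ℕ.+ p) ≡ b n) →
  (∀ n → n ℕ.< p → let v = s₀ · ι (b n) ⊕ s₁ · ι (b (1 ℕ.+ n)) ⊕ ι (b (2 ℕ.+ n)) in
    ℚ.- (¼ · δ) ℚ.≤ v × v ℚ.< 1ℚ) →
  ∀ n → b n ≡ 0ℤ
approximate-orbit-null s₀ s₁ t δ 0<δ -1+δ≤ ≤-½ 1+t≤ 11/5≤t b p b-periodic steps =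
  orbit-null {q} {ε} 0<ε ε≤1 6+ε<3q {η} 0<η 4η≤ε b p b-periodic bounds
  where
  q = s₁ ⊖ 1ℚ
  ε = s₀ ⊖ s₁ ⊕ 1ℚ
  -- Chosen so that `4 η = δ`, the lower bound for `ε`.
  η = ¼ · δ

  0<η : 0ℚ ℚ.< η
  0<η = *-pos (ℚ.positive⁻¹ ¼) 0<δ

  4η≤ε : 4ℚ · η ℚ.≤ ε
  4η≤ε = 0≤q-p⇒p≤q (subst (0ℚ ℚ.≤_)
    (solve 3 (λ s₀ s₁ δ → (s₀ :+ :- s₁) :- (con (ℚ.- 1ℚ) :+ δ) :=
                          (s₀ :- s₁ :+ con 1ℚ) :- con 4ℚ :* (con ¼ :* δ)) refl s₀ s₁ δ)
    (p≤q⇒0≤q-p -1+δ≤))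

  0<ε : 0ℚ ℚ.< ε
  0<ε = ℚ.<-≤-trans (*-pos (ℚ.positive⁻¹ 4ℚ) 0<η) 4η≤ε

  ε≤1 : ε ℚ.≤ 1ℚ
  ε≤1 = 0≤q-p⇒p≤q (subst (0ℚ ℚ.≤_)
    (solve 2 (λ s₀ s₁ → (con -½ :+ con 1/100 :- (s₀ :+ :- s₁)) :+ con (+ 49 ℚ./ 100) :=
                        con 1ℚ :- (s₀ :- s₁ :+ con 1ℚ)) refl s₀ s₁)
    (p≤q⇒0≤q-p ≤-½ +≤ ℚ.<⇒≤ (ℚ.positive⁻¹ (+ 49 ℚ./ 100))))

  -- The approximations give `3 q ≥ 6.57` and `ε ≤ 0.51`, with 6/100 to spare.
  6+ε<3q : 6ℚ ⊕ ε ℚ.< 3ℚ · q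
  6+ε<3q = 0<q-p⇒p<q (subst (0ℚ ℚ.<_)
    (solve 3 (λ s₀ s₁ t →
        con (+ 6 ℚ./ 100) :+ (con -½ :+ con 1/100 :- (s₀ :+ :- s₁))
          :+ con 3ℚ :* (s₁ :+ con 1/100 :- (con 1ℚ :+ t)) :+ con 3ℚ :* (t :- con 11/5)
        := con 3ℚ :* (s₁ :- con 1ℚ) :- (con 6ℚ :+ (s₀ :- s₁ :+ con 1ℚ))) refl s₀ s₁ t)
    (ℚ.positive⁻¹ (+ 6 ℚ./ 100) +< p≤q⇒0≤q-p ≤-½
      +< ℚ.<⇒≤ (ℚ.positive⁻¹ 3ℚ) *≤ p≤q⇒0≤q-p 1+t≤
      +< ℚ.<⇒≤ (ℚ.positive⁻¹ 3ℚ) *≤ p≤q⇒0≤q-p 11/5≤t))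

  bounds : ∀ n → let open Recurrence q ε (λ n → ι (b n)) in ℚ.- η ℚ.≤ e n × e n ℚ.< 1ℚ
  bounds n = subst (λ v → ℚ.- η ℚ.≤ v × v ℚ.< 1ℚ)
    (solve 5 (λ s₀ s₁ x y z → s₀ :* x :+ s₁ :* y :+ z :=
        ((s₁ :- con 1ℚ) :+ (s₀ :- s₁ :+ con 1ℚ)) :* x :+ ((s₁ :- con 1ℚ) :+ con 1ℚ) :* y :+ z)
      refl s₀ s₁ (ι (b n)) (ι (b (1 ℕ.+ n))) (ι (b (2 ℕ.+ n))))
    -- A constraint depends only on three consecutive terms, and such triples are periodic, so the
    -- indices below `p` suffice.
    (subst (λ (x , y , z) → let v = s₀ · ι x ⊕ s₁ · ι y ⊕ ι z in ℚ.- η ℚ.≤ v × v ℚ.< 1ℚ)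
      (sym (periodic-% {f = λ n → b n , b (1 ℕ.+ n) , b (2 ℕ.+ n)} p
        (λ n → cong₂ _,_ (b-periodic n)
          (cong₂ _,_ (b-periodic (1 ℕ.+ n)) (b-periodic (2 ℕ.+ n)))) n))
      (steps (n % p) (m%n<n n p)))

-- Passage to a single rational approximation

-- For a fixed rational error, `x ≤ y` unfolds to a statement of this form, as does `x < y` for its
-- rational gap.
Eventually : (ℕ → Set) → Set
Eventually P = ∃ λ N → ∀ i → N ℕ.≤ i → P i

infixr 2 _∧_
_∧_ : ∀ {P Q : ℕ → Set} → Eventually P → Eventually Q → Eventually (λ i → P i × Q i)
(M , f) ∧ (N , g) = M ℕ.⊔ N , λ i ≤i → f i (ℕ.m⊔n≤o⇒m≤o M N ≤i) , g i (ℕ.m⊔n≤o⇒n≤o M N ≤i)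

eventually-map : ∀ {P Q : ℕ → Set} → (∀ {i} → P i → Q i) → Eventually P → Eventually Q
eventually-map g (N , f) = N , λ i ≤i → g (f i ≤i)

-- The thresholds may grow with `n`; finitely many of them have a maximum.
eventually-∀< : ∀ {P : ℕ → ℕ → Set} → (∀ n → Eventually (P n)) →
                ∀ m → Eventually (λ i → ∀ n → n ℕ.< m → P n i)
eventually-∀< P-ev zero    = 0 , λ _ _ _ ()
eventually-∀< P-ev (suc m) with eventually-∀< P-ev m | P-ev m
... | M , f | N , g = M ℕ.⊔ N , λ i ≤i n n<1+m → case n i ≤i (ℕ.m<1+n⇒m<n∨m≡n n<1+m)
  where
  case : ∀ n i → M ℕ.⊔ N ℕ.≤ i → n ℕ.< m ⊎ n ≡ m → _
  case n i ≤i (inj₁ n<m)  = f i (ℕ.m⊔n≤o⇒m≤o M N ≤i) n n<m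
  case n i ≤i (inj₂ refl) = g i (ℕ.m⊔n≤o⇒n≤o M N ≤i)

eventually-∃ : ∀ {P : ℕ → Set} → Eventually P → ∃ P
eventually-∃ (N , f) = N , f N ℕ.≤-refl

0<1/100 : 0ℚ ℚ.< 1/100
0<1/100 = ℚ.positive⁻¹ 1/100

-- Since `(11/5)² = 4.84 < 5`, there is room for an error of 1/100 in both the sign and the square.
√5≥11/5 : Eventually λ i → 11/5 ℚ.≤ seq (√ 5) i
√5≥11/5 = eventually-map
  (λ {i} (h , h′) → ≥-from (seq (√ 5) i) h h′)
  (0≤√ 5 1/100 0<1/100 ∧ proj₂ (√-square 5) 1/100 0<1/100)
  where
  ≥-from : ∀ s → 0ℚ ℚ.≤ s ⊕ 1/100 → + 5 ℚ./ 1 ℚ.≤ s · s ⊕ 1/100 → 11/5 ℚ.≤ s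
  ≥-from s 0≤s 5≤s² = ℚ.≮⇒≥ λ s<11/5 → positive-≢ (ℚ.- (+ 3 ℚ./ 20))
    -- The constant 219/100 completes 1/100 to 11/5, so the product is `(11/5)² − s²`.
    (*-pos (p<q⇒0<q-p s<11/5) (ℚ.+-mono-≤-< 0≤s (ℚ.positive⁻¹ (+ 219 ℚ./ 100)))
      +< p≤q⇒0≤q-p 5≤s²)
    (solve 1 (λ s → (con 11/5 :- s) :* (s :+ con 1/100 :+ con (+ 219 ℚ./ 100))
        :+ (s :* s :+ con 1/100 :- con (+ 5 ℚ./ 1)) := con (ℚ.- (+ 3 ℚ./ 20))) refl s)

-- The strict inequality `X < k + 1` carries a rational gap `θ` and so survives approximation,
-- whereas `k ≤ X` survives only up to `η`. This is why the tolerance is one-sided.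
step-approx : ∀ {r₀ r₁ a} → IsOrbit (r₀ , r₁) a → ∀ η → 0ℚ ℚ.< η → ∀ n →
  Eventually λ i → let v = seq r₀ i · ι (a n) ⊕ seq r₁ i · ι (a (1 ℕ.+ n)) ⊕ ι (a (2 ℕ.+ n)) in
    ℚ.- η ℚ.≤ v × v ℚ.< 1ℚ
step-approx {r₀} {r₁} {a} orbit η 0<η n with orbit n
... | k , (k≤X , θ , 0<θ , X<k+1) , eq = eventually-map
  (λ {i} (h , h′) → let X = seq r₀ i · ι (a n) ⊕ seq r₁ i · ι (a (1 ℕ.+ n)) in
    subst (λ w → ℚ.- η ℚ.≤ X ⊕ w × X ⊕ w ℚ.< 1ℚ) (sym a₂≡)
      ( 0≤q-p⇒p≤q (subst (0ℚ ℚ.≤_)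
          (solve 3 (λ X η k → X :+ η :- k := X :+ :- k :- :- η) refl X η (ι k)) (p≤q⇒0≤q-p h))
      , 0<q-p⇒p<q (subst (0ℚ ℚ.<_)
          (solve 3 (λ X θ k → θ :+ (k :+ con 1ℚ :- (X :+ θ)) := con 1ℚ :- (X :+ :- k)) refl X θ (ι k))
          (0<θ +< p≤q⇒0≤q-p (subst (X ⊕ θ ℚ.≤_) (ι-+ k (+ 1)) h′)))))
  (k≤X η 0<η ∧ X<k+1)
  where
  a₂≡ : ι (a (2 ℕ.+ n)) ≡ ℚ.- ι k
  a₂≡ = trans (cong (λ b → ι (proj₂ b)) eq) (ι-neg k)

-- Reduction of a real orbit to one rational approximation

theorem6 : (λ (r₀ , r₁) →
    fromℤ -[1+ 0 ] < r₀ - r₁ ×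
    r₀ - r₁ ≤ fromℚ -½ ×
    fromℤ (+ 1) + √ 5 ≤ r₁ ×
    fromℤ (+ 4) * r₀ ≤ r₁ * r₁)
    ⊆ 𝒟₂⁽*⁾
theorem6 {r₀ , r₁} ((δ , 0<δ , -1<r₀-r₁) , r₀-r₁≤-½ , 1+√5≤r₁ , _)
  a orbit (n₀ , p , 0<p , a-periodic) =
    let i , -1+δ≤ , ≤-½ , 1+t≤ , 11/5≤t , steps = eventually-∃
          (-1<r₀-r₁
          ∧ r₀-r₁≤-½ 1/100 0<1/100
          ∧ 1+√5≤r₁ 1/100 0<1/100
          ∧ √5≥11/5
          -- The gap `δ` in `−1 < r₀ − r₁` fixes the tolerance before the index `i` is chosen.
          ∧ eventually-∀< (step-approx {r₀} {r₁} {b} b-orbit (¼ · δ)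
                            (*-pos (ℚ.positive⁻¹ ¼) 0<δ)) p)
    in n₀ , λ n n₀≤n → trans (cong a (sym (ℕ.m+[n∸m]≡n n₀≤n)))
         (approximate-orbit-null (seq r₀ i) (seq r₁ i) (seq (√ 5) i) δ 0<δ
           -1+δ≤ ≤-½ 1+t≤ 11/5≤t b p b-periodic steps (n ℕ.∸ n₀))
  where
  instance
    p≢0 : ℕ.NonZero p
    p≢0 = ℕ.>-nonZero 0<p

  -- Dropping the preperiod makes the orbit purely periodic.
  b : ℕ → ℤ
  b n = a (n₀ ℕ.+ n)

  b-periodic : ∀ n → b (n ℕ.+ p) ≡ b n
  b-periodic n = trans (cong a (sym (ℕ.+-assoc n₀ n p))) (a-periodic (n₀ ℕ.+ n) (ℕ.m≤m+n n₀ n))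

  b-orbit : IsOrbit (r₀ , r₁) b
  b-orbit n = subst₂ (λ j k → τ⟨ r₀ , r₁ ⟩ (b n , a j) ↦ (a j , a k))
    (sym (ℕ.+-suc n₀ n)) (sym (trans (ℕ.+-suc n₀ (1 ℕ.+ n)) (cong suc (ℕ.+-suc n₀ n))))
    (orbit (n₀ ℕ.+ n))
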